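{- For every positive integer $n$, the set of monomials $B_{\mathfrak{B}_n}^{(1,2)}$ has cardinality $4^n\,n!$.
   Context: A type $B$ modified Motzkin path of length $n$ is a lattice path $\pi=(p_1,\ldots,p_n)$ in $\mathbb{Z}^2$ starting at $(0,0)$ whose $i$-th step $p_i$ is one of: an (undecorated) up-step $(1,1)$; a horizontal step $(1,0)$ with decoration $\theta_i$; a horizontal step $(1,0)$ with decoration $\xi_i$; a down-step $(1,-1)$ with decoration $\theta_i\xi_i$; such that the path never goes below the line $y=0$. The set of these paths is $\Pi(n)_{\ge0}$. For $\pi\in\Pi(n)_{\ge0}$ let $T(\pi)$ (resp. $S(\pi)$) be the set of indices $i\in\{1,\ldots,n\}$ such that $\theta_i$ (resp. $\xi_i$) occurs in the decoration of $p_i$. For $T,S\subseteq\{1,\ldots,n\}$ define $\beta(T,S)=(\beta_1(T,S),\ldots,\beta_n(T,S))$ by $\beta_1(T,S)=-1+\chi(1\notin T)+\chi(1\notin S)$ and, for $2\le i\le n$, $\beta_i(T,S)=\beta_{i-1}(T,S)-2+\chi(i\notin T)+\chi(i-1\notin T)+\chi(i\notin S)+\chi(i-1\notin S)$, where $\chi(P)=1$ if $P$ is true and $0$ otherwise. The variables $x_i$ commute with all variables; the variables $\theta_i,\xi_i$ anticommute with one another. $\theta_T,\xi_S$ denote products in increasing order of indices and $x^\beta=x_1^{\beta_1}\cdots x_n^{\beta_n}$. Then $B_{\mathfrak{B}_n}^{(1,2)}$ is the set of monomials $x^\beta\theta_T\xi_S$ such that $(T,S)=(T(\pi),S(\pi))$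 for some $\pi\in\Pi(n)_{\ge0}$ and $0\le\beta_i\le\beta_i(T,S)$ for all $i\in\{1,\ldots,n\}$. (Signs of monomials are irrelevant; an element is determined by the triple $(\beta,T,S)$.) -}

module Defs where

open import Data.Bool using (Bool; true; false; if_then_else_)
open import Data.Fin using (Fin; zero; suc; toℕ; fromℕ<)
open import Data.Fin.Properties using (toℕ<n)
open import Data.Fin.Subset using (Subset; _∉_)
open import Data.Fin.Subset.Properties using (_∈?_)
open import Data.Integer as ℤ using (ℤ; +_; 0ℤ; 1ℤ; -1ℤ)
open import Data.List using (List; length)
open import Data.List.Membership.Propositional using () renaming (_∈_ to _∈ₗ_)
open import Data.List.Relation.Unary.Unique.Propositional using (Unique)
open import Data.Nat as ℕ using (ℕ; zero; suc)
open import Data.Nat.Properties using (<-trans; n<1+n)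
open import Data.Product using (_×_; _,_; proj₂; ∃; ∃-syntax)
open import Data.Vec using (Vec; []; _∷_; lookup; map)
open import Function.Bundles using (_⇔_)
open import Relation.Binary.PropositionalEquality using (_≡_)
open import Relation.Nullary using (Dec; ¬?; does)
open import Relation.Unary using (Pred)

-- Indices are 0-based throughout: i : Fin n stands for the index toℕ i + 1.

-- The decorations are those of the step's own index i:
-- none, θᵢ, ξᵢ and θᵢξᵢ respectively.
data Step : Set where
  up horizontal-θ horizontal-ξ down : Step

Point : Set
Point = ℤ × ℤ

displacement : Step → Point
displacement up           = 1ℤ , 1ℤ
displacement horizontal-θ = 1ℤ , 0ℤ
displacement horizontal-ξ = 1ℤ , 0ℤ
displacement down         = 1ℤ , -1ℤ

translate : Point → Point → Point
translate (x , y) (dx , dy) = x ℤ.+ dx , y ℤ.+ dy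

Path : ℕ → Set
Path n = Vec Step n

-- A path with n steps visits n + 1 lattice points.
vertexFrom : ∀ {n} → Point → Path n → Fin (suc n) → Point
vertexFrom p π       zero    = p
vertexFrom p (s ∷ π) (suc i) = vertexFrom (translate p (displacement s)) π i

vertex : ∀ {n} → Path n → Fin (suc n) → Point
vertex = vertexFrom (0ℤ , 0ℤ)

-- Π(n)_{≥0}
Motzkinᴮ : ∀ {n} → Pred (Path n) _
Motzkinᴮ π = ∀ i → 0ℤ ℤ.≤ proj₂ (vertex π i)

has-θ : Step → Bool
has-θ up           = false
has-θ horizontal-θ = true
has-θ horizontal-ξ = false
has-θ down         = true

has-ξ : Step → Bool
has-ξ up           = false
has-ξ horizontal-θ = false
has-ξ horizontal-ξ = true
has-ξ down         = true

T⟨_⟩ : ∀ {n} → Path n → Subset n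
T⟨ π ⟩ = map has-θ π

S⟨_⟩ : ∀ {n} → Path n → Subset n
S⟨ π ⟩ = map has-ξ π

χ : ∀ {p} {P : Set p} → Dec P → ℤ
χ P? = if does P? then 1ℤ else 0ℤ

_∉?_ : ∀ {n} (i : Fin n) (p : Subset n) → Dec (i ∉ p)
i ∉? p = ¬? (i ∈? p)

-- The recurrence runs over a natural number k < n, since recursion from suc i
-- to its predecessor inject₁ i in Fin n is not structural.
β-rec : ∀ {n} (T S : Subset n) (k : ℕ) → .(k ℕ.< n) → ℤ
β-rec T S zero    k<n = -1ℤ ℤ.+ χ (i ∉? T) ℤ.+ χ (i ∉? S)
  where i = fromℕ< k<n
β-rec T S (suc k) k<n =
  β-rec T S k (<-trans (n<1+n k) k<n) ℤ.- (+ 2)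
    ℤ.+ χ (i ∉? T) ℤ.+ χ (j ∉? T) ℤ.+ χ (i ∉? S) ℤ.+ χ (j ∉? S)
  where
  i = fromℕ< k<n
  j = fromℕ< (<-trans (n<1+n k) k<n)

β⟨_,_⟩ : ∀ {n} → Subset n → Subset n → Fin n → ℤ
β⟨ T , S ⟩ i = β-rec T S (toℕ i) (toℕ<n i)

-- The monomial x^β θ_T ξ_S up to sign. Exponents are natural numbers, which
-- accounts for the condition 0 ≤ βᵢ.
record Monomial (n : ℕ) : Set where
  constructor x^_θ_ξ_
  field
    exponent : Vec ℕ n
    θ-set    : Subset n
    ξ-set    : Subset n

-- B_{𝔅ₙ}^{(1,2)}
B⁽¹'²⁾ : ∀ n → Pred (Monomial n) _
B⁽¹'²⁾ n (x^ β θ T ξ S) =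
  (∃[ π ] Motzkinᴮ {n} π × T ≡ T⟨ π ⟩ × S ≡ S⟨ π ⟩)
  × (∀ i → + lookup β i ℤ.≤ β⟨ T , S ⟩ i)

HasCardinality : ∀ {a ℓ} {A : Set a} → Pred A ℓ → ℕ → Set _
HasCardinality {A = A} P k =
  ∃[ xs ] Unique xs × (∀ (x : A) → x ∈ₗ xs ⇔ P x) × length xs ≡ k

{-# OPTIONS --safe #-}
module Submission where

-- If hᵢ is the height after i steps, then β_i = h_{i-1} + h_i, so a step from
-- height h carries 2h + 2, 2h + 1, 2h + 1 or 2h choices of exponent (up, θ, ξ, down).
-- Let f_n(h) be the number of labelled paths of length n starting from height h.
-- By induction on n the recurrence
--   f_{n+1}(h) = (2h + 2) f_n(h + 1) + 2 (2h + 1) f_n(h) + 2h f_n(h - 1)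
-- implies the Delannoy-type relation
--   f_{n+1}(h + 1) = f_{n+1}(h) + 4 (n + 1) (f_n(h + 1) + f_n(h)),
-- that is, f_n(h) / (4^n n!) is a Delannoy number. At h = 0 the two relations give
-- f_{n+1}(0) = 4 (n + 1) f_n(0).

open import Defs
open import Data.Fin using (Fin; zero; suc; toℕ; fromℕ<; inject₁)
open import Data.Fin.Properties using (toℕ<n; toℕ-fromℕ<; toℕ-inject₁; toℕ-injective; fromℕ<-toℕ)
open import Data.Integer as ℤ using (ℤ; +_; 0ℤ; 1ℤ; -1ℤ)
import Data.Integer.Properties as ℤ
import Data.Integer.Tactic.RingSolver as ℤ-Ring
open import Data.List using (List; []; _∷_; length; map; upTo; concatMap; cartesianProductWith)
open import Data.List.Membership.Propositional using (_∈_)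
open import Data.List.Membership.Propositional.Properties
  using (∈-upTo⁺; ∈-upTo⁻; ∈-cartesianProductWith⁺; ∈-cartesianProductWith⁻; ∈-concatMap⁺; ∈-concatMap⁻)
open import Data.List.Properties using (length-++; length-map; length-upTo; map-cong)
open import Data.List.Relation.Binary.Disjoint.Propositional using (Disjoint)
import Data.List.Relation.Unary.All as All
import Data.List.Relation.Unary.All.Properties as All
import Data.List.Relation.Unary.AllPairs as AllPairs
import Data.List.Relation.Unary.AllPairs.Properties as AllPairs
open import Data.List.Relation.Unary.Any as Any using (here; there; satisfied)
open import Data.List.Relation.Unary.Unique.Propositional using (Unique; []; _∷_)
import Data.List.Relation.Unary.Unique.Propositional.Properties as Unique
open import Data.Nat using (ℕ; zero; suc; pred; _+_; _*_; _^_; _!; _<_; z≤n; s≤s; s≤s⁻¹; NonZero)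
open import Data.Nat.ListAction using (sum)
open import Data.Nat.Properties using (<-trans; n<1+n; +-comm; +-identityʳ)
open import Data.Nat.Tactic.RingSolver using (solve-∀)
open import Data.Product using (_×_; _,_; proj₁; proj₂; ∃-syntax)
open import Data.Vec using (Vec; []; _∷_; lookup)
open import Function using (_∘_; _⇔_; mk⇔; Equivalence)
open import Relation.Binary.PropositionalEquality
  using (_≡_; _≢_; refl; sym; trans; cong; cong₂; subst; module ≡-Reasoning)

-- Exponent bounds as sums of consecutive heights.

height : ∀ {n} → Point → Path n → Fin (suc n) → ℤ
height p π i = proj₂ (vertexFrom p π i)

rise : Step → ℤ
rise s = proj₂ (displacement s)

height-suc : ∀ {n} p (π : Path n) i →
             height p π (suc i) ≡ height p π (inject₁ i) ℤ.+ rise (lookup π i)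
height-suc p (s ∷ π) zero    = refl
height-suc p (s ∷ π) (suc i) = height-suc (translate p (displacement s)) π i

-- An up-step rises by 1, and each of θᵢ and ξᵢ in a decoration lowers the rise by 1.
rise-χ : ∀ {n} (π : Path n) i →
         rise (lookup π i) ≡ -1ℤ ℤ.+ χ (i ∉? T⟨ π ⟩) ℤ.+ χ (i ∉? S⟨ π ⟩)
rise-χ (up           ∷ π) zero    = refl
rise-χ (horizontal-θ ∷ π) zero    = refl
rise-χ (horizontal-ξ ∷ π) zero    = refl
rise-χ (down         ∷ π) zero    = refl
rise-χ (s            ∷ π) (suc i) = rise-χ π i

-- The vertex after step `k` is the vertex before the following step, so the height shared by two
-- consecutive bounds can be recognised under both of its indices.
inject₁-fromℕ< : ∀ {n k} .(k<n : k < n) .(1+k<n : suc k < n) →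
                 inject₁ (fromℕ< 1+k<n) ≡ suc (fromℕ< k<n)
inject₁-fromℕ< {n} {k} k<n 1+k<n = toℕ-injective (begin
  toℕ (inject₁ (fromℕ< 1+k<n)) ≡⟨ toℕ-inject₁ (fromℕ< 1+k<n) ⟩
  toℕ (fromℕ< 1+k<n)           ≡⟨ toℕ-fromℕ< 1+k<n ⟩
  suc k                        ≡⟨ cong suc (toℕ-fromℕ< k<n) ⟨
  suc (toℕ (fromℕ< k<n))       ∎)
  where open ≡-Reasoning

-- With `y` the height before two consecutive steps, their rises are `-1ℤ + b + d` and
-- `-1ℤ + a + c`. Passing from one bound to the next adds both rises, and `- 2` collects the two
-- `-1ℤ`.
β-step : ∀ y a b c d →
         (y ℤ.+ (y ℤ.+ (-1ℤ ℤ.+ b ℤ.+ d))) ℤ.- (+ 2) ℤ.+ a ℤ.+ b ℤ.+ c ℤ.+ d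
         ≡ (y ℤ.+ (-1ℤ ℤ.+ b ℤ.+ d)) ℤ.+ ((y ℤ.+ (-1ℤ ℤ.+ b ℤ.+ d)) ℤ.+ (-1ℤ ℤ.+ a ℤ.+ c))
β-step = ℤ-Ring.solve-∀

β-rec-height : ∀ {n} (π : Path n) k .(k<n : k < n) →
               β-rec T⟨ π ⟩ S⟨ π ⟩ k k<n
               ≡ height (0ℤ , 0ℤ) π (inject₁ (fromℕ< k<n)) ℤ.+ height (0ℤ , 0ℤ) π (suc (fromℕ< k<n))
β-rec-height {suc n} π@(s ∷ _) zero k<n = begin
  -1ℤ ℤ.+ χ (zero ∉? T⟨ π ⟩) ℤ.+ χ (zero ∉? S⟨ π ⟩) ≡⟨ rise-χ π zero ⟨
  rise s                                            ≡⟨ ℤ.+-identityˡ (rise s) ⟨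
  0ℤ ℤ.+ rise s                                     ≡⟨ ℤ.+-identityˡ _ ⟨
  0ℤ ℤ.+ (0ℤ ℤ.+ rise s)                            ∎
  where open ≡-Reasoning
β-rec-height {n} π (suc k) 1+k<n = begin
  β-rec T⟨ π ⟩ S⟨ π ⟩ k (<-trans (n<1+n k) 1+k<n) ℤ.- (+ 2) ℤ.+ a ℤ.+ b ℤ.+ c ℤ.+ d
    ≡⟨ cong (λ z → z ℤ.- (+ 2) ℤ.+ a ℤ.+ b ℤ.+ c ℤ.+ d)
         (trans (β-rec-height π k (<-trans (n<1+n k) 1+k<n)) (cong (λ z → y₀ ℤ.+ z) y₁≡)) ⟩
  (y₀ ℤ.+ (y₀ ℤ.+ (-1ℤ ℤ.+ b ℤ.+ d))) ℤ.- (+ 2) ℤ.+ a ℤ.+ b ℤ.+ c ℤ.+ d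
    ≡⟨ β-step y₀ a b c d ⟩
  (y₀ ℤ.+ (-1ℤ ℤ.+ b ℤ.+ d)) ℤ.+ ((y₀ ℤ.+ (-1ℤ ℤ.+ b ℤ.+ d)) ℤ.+ (-1ℤ ℤ.+ a ℤ.+ c))
    ≡⟨ cong (λ z → z ℤ.+ (z ℤ.+ (-1ℤ ℤ.+ a ℤ.+ c))) y₁≡ ⟨
  y₁ ℤ.+ (y₁ ℤ.+ (-1ℤ ℤ.+ a ℤ.+ c))
    ≡⟨ cong (λ z → z ℤ.+ (z ℤ.+ (-1ℤ ℤ.+ a ℤ.+ c))) (cong y (inject₁-fromℕ< (<-trans (n<1+n k) 1+k<n) 1+k<n)) ⟨
  y (inject₁ i) ℤ.+ (y (inject₁ i) ℤ.+ (-1ℤ ℤ.+ a ℤ.+ c))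
    ≡⟨ cong (λ z → y (inject₁ i) ℤ.+ z) (y-suc i) ⟨
  y (inject₁ i) ℤ.+ y (suc i) ∎
  where
  open ≡-Reasoning
  i = fromℕ< 1+k<n
  j = fromℕ< (<-trans (n<1+n k) 1+k<n)
  y = height (0ℤ , 0ℤ) π
  y₀ = y (inject₁ j)
  y₁ = y (suc j)
  a = χ (i ∉? T⟨ π ⟩)
  b = χ (j ∉? T⟨ π ⟩)
  c = χ (i ∉? S⟨ π ⟩)
  d = χ (j ∉? S⟨ π ⟩)
  y-suc : ∀ i → y (suc i) ≡ y (inject₁ i) ℤ.+ (-1ℤ ℤ.+ χ (i ∉? T⟨ π ⟩) ℤ.+ χ (i ∉? S⟨ π ⟩))
  y-suc i = trans (height-suc (0ℤ , 0ℤ) π i) (cong (λ z → y (inject₁ i) ℤ.+ z) (rise-χ π i))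
  y₁≡ = y-suc j

β-height : ∀ {n} (π : Path n) i →
           β⟨ T⟨ π ⟩ , S⟨ π ⟩ ⟩ i ≡ height (0ℤ , 0ℤ) π (inject₁ i) ℤ.+ height (0ℤ , 0ℤ) π (suc i)
β-height π i = trans (β-rec-height π (toℕ i) (toℕ<n i))
  (cong (λ j → height (0ℤ , 0ℤ) π (inject₁ j) ℤ.+ height (0ℤ , 0ℤ) π (suc j)) (fromℕ<-toℕ i (toℕ<n i)))

-- Enumeration of the labelled paths.

steps : List Step
steps = up ∷ horizontal-θ ∷ horizontal-ξ ∷ down ∷ []

∈-steps : ∀ s → s ∈ steps
∈-steps up           = here refl
∈-steps horizontal-θ = there (here refl)
∈-steps horizontal-ξ = there (there (here refl))
∈-steps down         = there (there (there (here refl)))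

steps-unique : Unique steps
steps-unique = ((λ ()) All.∷ (λ ()) All.∷ (λ ()) All.∷ All.[])
             ∷ ((λ ()) All.∷ (λ ()) All.∷ All.[])
             ∷ ((λ ()) All.∷ All.[])
             ∷ All.[] ∷ []

-- For a down-step from height 0 the value `pred 0` is a dummy: `choices` vanishes there.
next : ℕ → Step → ℕ
next h up           = suc h
next h horizontal-θ = h
next h horizontal-ξ = h
next h down         = pred h

-- The number of exponents a step from height h allows, namely h + next h s + 1;
-- it is 0 for the forbidden down-step from height 0.
choices : ℕ → Step → ℕ
choices h up           = 2 * suc h
choices h horizontal-θ = suc (2 * h)
choices h horizontal-ξ = suc (2 * h)
choices h down         = 2 * h

prepend : ∀ {n} → Step → ℕ → Monomial n → Monomial (suc n)
prepend s b (x^ β θ T ξ S) = x^ (b ∷ β) θ (has-θ s ∷ T) ξ (has-ξ s ∷ S)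

-- The pair `has-θ s`, `has-ξ s` determines `s`. Hence different first steps yield disjoint lists in
-- `admissible-unique`.
prepend-injective : ∀ {n} s s′ {b b′} {m m′ : Monomial n} →
                    prepend s b m ≡ prepend s′ b′ m′ → s ≡ s′ × b ≡ b′ × m ≡ m′
prepend-injective up           up           refl = refl , refl , refl
prepend-injective horizontal-θ horizontal-θ refl = refl , refl , refl
prepend-injective horizontal-ξ horizontal-ξ refl = refl , refl , refl
prepend-injective down         down         refl = refl , refl , refl

-- Nonnegativity of the path is encoded in `b < choices h s`, which fails for a down-step from
-- height 0.
data Admissible (h : ℕ) : ∀ {n} → Monomial n → Set where
  nil  : Admissible h (x^ [] θ [] ξ [])
  cons : ∀ {n} s {b} {m : Monomial n} →
         b < choices h s → Admissible (next h s) m → Admissible h (prepend s b m)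

extensions : ∀ {n} → ℕ → (ℕ → List (Monomial n)) → Step → List (Monomial (suc n))
extensions h rest s = cartesianProductWith (prepend s) (upTo (choices h s)) (rest (next h s))

admissible : ∀ n → ℕ → List (Monomial n)
admissible zero    h = (x^ [] θ [] ξ []) ∷ []
admissible (suc n) h = concatMap (extensions h (admissible n)) steps

admissible-sound : ∀ n h {m} → m ∈ admissible n h → Admissible h m
admissible-sound zero    h (here refl) = nil
admissible-sound (suc n) h m∈
  with s , m∈s ← satisfied (∈-concatMap⁻ (extensions h (admissible n)) {xs = steps} m∈)
  with b , m′ , b∈ , m′∈ , refl ←
    ∈-cartesianProductWith⁻ (prepend s) (upTo (choices h s)) (admissible n (next h s)) m∈s
  = cons s (∈-upTo⁻ b∈) (admissible-sound n (next h s) m′∈)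

admissible-complete : ∀ {n h} {m : Monomial n} → Admissible h m → m ∈ admissible n h
admissible-complete nil = here refl
admissible-complete {suc n} {h} (cons s b< m-adm) =
  ∈-concatMap⁺ (extensions h (admissible n))
    (Any.map (λ { refl → ∈-cartesianProductWith⁺ (prepend s) (∈-upTo⁺ b<) (admissible-complete m-adm) })
      (∈-steps s))

admissible-unique : ∀ n h → Unique (admissible n h)
admissible-unique zero    h = All.[] ∷ []
admissible-unique (suc n) h = Unique.concat⁺
  (All.map⁺ (All.universal extensions-unique steps))
  (AllPairs.map⁺ (AllPairs.map disjoint steps-unique))
  where
  extensions-unique : ∀ s → Unique (extensions h (admissible n) s)
  extensions-unique s = Unique.cartesianProductWith⁺ (prepend s)
    (proj₂ ∘ prepend-injective s s) (Unique.upTo⁺ (choices h s)) (admissible-unique n (next h s))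
  disjoint : ∀ {s s′} → s ≢ s′ →
             Disjoint (extensions h (admissible n) s) (extensions h (admissible n) s′)
  disjoint {s} {s′} s≢s′ (m∈ , m∈′)
    with _ , _ , _ , _ , refl ← ∈-cartesianProductWith⁻ (prepend s) (upTo (choices h s)) _ m∈
       | _ , _ , _ , _ , eq   ← ∈-cartesianProductWith⁻ (prepend s′) (upTo (choices h s′)) _ m∈′
    = s≢s′ (proj₁ (prepend-injective s s′ eq))

-- Length of the enumeration.

length-concatMap : ∀ {a b} {A : Set a} {B : Set b} (f : A → List B) xs →
                   length (concatMap f xs) ≡ sum (map (length ∘ f) xs)
length-concatMap f []       = refl
length-concatMap f (x ∷ xs) =
  trans (length-++ (f x)) (cong (λ k → length (f x) + k) (length-concatMap f xs))

length-cartesianProductWith : ∀ {a b c} {A : Set a} {B : Set b} {C : Set c} (f : A → B → C) xs ys →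
                              length (cartesianProductWith f xs ys) ≡ length xs * length ys
length-cartesianProductWith f []       ys = refl
length-cartesianProductWith f (x ∷ xs) ys = trans (length-++ (map (f x) ys))
  (cong₂ _+_ (length-map (f x) ys) (length-cartesianProductWith f xs ys))

-- This is f_n(h). The sum over `steps` unfolds to the expression `L` below, which therefore keeps
-- the two horizontal terms apart and ends in `+ 0`.
count : ℕ → ℕ → ℕ
count zero    h = 1
count (suc n) h = sum (map (λ s → choices h s * count n (next h s)) steps)

length-admissible : ∀ n h → length (admissible n h) ≡ count n h
length-admissible zero    h = refl
length-admissible (suc n) h =
  trans (length-concatMap (extensions h (admissible n)) steps)
    (cong sum (map-cong length-extensions steps))
  where
  length-extensions : ∀ s → length (extensions h (admissible n) s) ≡ choices h s * count n (next h s)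
  length-extensions s = trans
    (length-cartesianProductWith (prepend s) (upTo (choices h s)) (admissible n (next h s)))
    (cong₂ _*_ (length-upTo (choices h s)) (length-admissible n (next h s)))

-- The Delannoy-type relation and the count from height 0.

-- L is one step of the recurrence for count, g and e stand for count (suc n) and
-- count n, and C = 4 (n + 1). L e is not replaced by g here, so that this is a
-- semiring identity in the values of e and the lowest value of g.
L-difference-zero : ∀ C e₀ e₁ e₂ g₀ →
  let g₁ = g₀ + C * (e₁ + e₀)
      g₂ = g₁ + C * (e₂ + e₁)
      L : ℕ → ℕ → ℕ → ℕ → ℕ
      L h x y z = 2 * suc h * x + (suc (2 * h) * y + (suc (2 * h) * y + (2 * h * z + 0)))
  in L 1 g₂ g₁ g₀ ≡ L 0 g₁ g₀ g₀ + (C * (L 1 e₂ e₁ e₀ + L 0 e₁ e₀ e₀) + 4 * (g₁ + g₀))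
L-difference-zero = solve-∀

L-difference-suc : ∀ C k e₀ e₁ e₂ e₃ g₀ →
  let g₁ = g₀ + C * (e₁ + e₀)
      g₂ = g₁ + C * (e₂ + e₁)
      g₃ = g₂ + C * (e₃ + e₂)
      L : ℕ → ℕ → ℕ → ℕ → ℕ
      L h x y z = 2 * suc h * x + (suc (2 * h) * y + (suc (2 * h) * y + (2 * h * z + 0)))
  in L (suc (suc k)) g₃ g₂ g₁
     ≡ L (suc k) g₂ g₁ g₀ + (C * (L (suc (suc k)) e₃ e₂ e₁ + L (suc k) e₂ e₁ e₀) + 4 * (g₂ + g₁))
L-difference-suc = solve-∀

-- Induction on `n` for all heights at once: the case `h` uses the hypothesis at h - 1 (if h > 0), h
-- and h + 1. Subtracting the recurrences at h + 1 and h turns the factor `C` into `C` + 4 = 4 (n +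
-- 2).
count-difference : ∀ n h →
  count (suc n) (suc h) ≡ count (suc n) h + 4 * suc n * (count n (suc h) + count n h)
count-difference zero h = initial h
  where
  initial : ∀ h →
    2 * suc (suc h) * 1 + (suc (2 * suc h) * 1 + (suc (2 * suc h) * 1 + (2 * suc h * 1 + 0)))
    ≡ (2 * suc h * 1 + (suc (2 * h) * 1 + (suc (2 * h) * 1 + (2 * h * 1 + 0)))) + 4 * 1 * (1 + 1)
  initial = solve-∀
count-difference (suc n) h = trans (step h) (cong (λ k → count (suc (suc n)) h + k) (collect n (g (suc h) + g h)))
  where
  e g : ℕ → ℕ
  e = count n
  g = count (suc n)
  C = 4 * suc n
  collect : ∀ n x → 4 * suc n * x + 4 * x ≡ 4 * suc (suc n) * x
  collect = solve-∀
  g₁≡ : ∀ h → g (suc h) ≡ g h + C * (e (suc h) + e h)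
  g₁≡ = count-difference n
  g₂≡ : ∀ h → g (2 + h) ≡ g h + C * (e (suc h) + e h) + C * (e (2 + h) + e (suc h))
  g₂≡ h = trans (g₁≡ (suc h)) (cong (λ k → k + C * (e (2 + h) + e (suc h))) (g₁≡ h))
  g₃≡ : ∀ h → g (3 + h) ≡ g h + C * (e (suc h) + e h) + C * (e (2 + h) + e (suc h))
                          + C * (e (3 + h) + e (2 + h))
  g₃≡ h = trans (g₁≡ (2 + h)) (cong (λ k → k + C * (e (3 + h) + e (2 + h))) (g₂≡ h))
  L : ℕ → ℕ → ℕ → ℕ → ℕ
  L h x y z = 2 * suc h * x + (suc (2 * h) * y + (suc (2 * h) * y + (2 * h * z + 0)))
  step : ∀ h → count (suc (suc n)) (suc h)
               ≡ count (suc (suc n)) h + (C * (g (suc h) + g h) + 4 * (g (suc h) + g h))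
  -- At height 0 the dummy value of `next` makes `g 0` the last argument of `L 0`, with coefficient
  -- 0.
  step zero = lemma (g₁≡ 0) (g₂≡ 0)
    where
    -- Only the values inside `L` and after the factor 4 are abstracted, so that `refl` expands
    -- them; `g 1` and `g 0` after `C` instead unfold to `L` applied to values of `e`.
    lemma : ∀ {g₁ g₂} → g₁ ≡ g 0 + C * (e 1 + e 0) →
            g₂ ≡ g 0 + C * (e 1 + e 0) + C * (e 2 + e 1) →
            L 1 g₂ g₁ (g 0) ≡ L 0 g₁ (g 0) (g 0) + (C * (g 1 + g 0) + 4 * (g₁ + g 0))
    lemma refl refl = L-difference-zero C (e 0) (e 1) (e 2) (g 0)
  step (suc k) = lemma (g₁≡ k) (g₂≡ k) (g₃≡ k)
    where
    lemma : ∀ {g₁ g₂ g₃} → g₁ ≡ g k + C * (e (1 + k) + e k) →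
            g₂ ≡ g k + C * (e (1 + k) + e k) + C * (e (2 + k) + e (1 + k)) →
            g₃ ≡ g k + C * (e (1 + k) + e k) + C * (e (2 + k) + e (1 + k)) + C * (e (3 + k) + e (2 + k)) →
            L (2 + k) g₃ g₂ g₁
            ≡ L (1 + k) g₂ g₁ (g k) + (C * (g (2 + k) + g (1 + k)) + 4 * (g₂ + g₁))
    lemma refl refl refl = L-difference-suc C k (e k) (e (1 + k)) (e (2 + k)) (e (3 + k)) (g k)

-- By the recurrence f_{n+1}(0) = 2 (f_n(1) + f_n(0)), so the relation at h = 0 becomes f_{n+1}(1) =
-- (1 + 2 (n + 1)) f_{n+1}(0). Insert this in f_{n+2}(0) = 2 (f_{n+1}(1) + f_{n+1}(0)).
count-zero-suc : ∀ n → count (suc n) 0 ≡ 4 * suc n * count n 0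
count-zero-suc zero    = refl
count-zero-suc (suc n) = trans (cong (λ k → 2 * k + (g₀ + 0 + (g₀ + 0 + 0))) g₁≡) (collect n g₀)
  where
  g₀ = count (suc n) 0
  halve : ∀ n x y → 4 * suc n * (x + y) ≡ 2 * suc n * (2 * x + (y + 0 + (y + 0 + 0)))
  halve = solve-∀
  g₁≡ : count (suc n) 1 ≡ g₀ + 2 * suc n * g₀
  g₁≡ = trans (count-difference n 0) (cong (λ k → g₀ + k) (halve n (count n 1) (count n 0)))
  collect : ∀ n x → 2 * (x + 2 * suc n * x) + (x + 0 + (x + 0 + 0)) ≡ 4 * suc (suc n) * x
  collect = solve-∀

count-zero : ∀ n → count n 0 ≡ 4 ^ n * n !
count-zero zero    = refl
count-zero (suc n) = trans (count-zero-suc n)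
  (trans (cong (λ k → 4 * suc n * k) (count-zero n)) (rearrange (suc n) (4 ^ n) (n !)))
  where
  rearrange : ∀ m p f → 4 * m * (p * f) ≡ 4 * p * (m * f)
  rearrange = solve-∀

-- Admissible monomials are the elements of B.

-- The hypothesis excludes the down-step from height 0, where the left side is 0 and the right side
-- is 1.
choices≡ : ∀ h s → 0ℤ ℤ.≤ + h ℤ.+ rise s → choices h s ≡ suc (h + next h s)
choices≡ h       up           _ = double h
  where
  double : ∀ h → 2 * suc h ≡ suc (h + suc h)
  double = solve-∀
choices≡ h       horizontal-θ _ = cong (λ k → suc (h + k)) (+-identityʳ h)
choices≡ h       horizontal-ξ _ = cong (λ k → suc (h + k)) (+-identityʳ h)
choices≡ (suc h) down         _ = double h
  where
  double : ∀ h → 2 * suc h ≡ suc (suc h + h)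
  double = solve-∀

next≡ : ∀ h s → 0ℤ ℤ.≤ + h ℤ.+ rise s → + h ℤ.+ rise s ≡ + next h s
next≡ h       up           _ = cong +_ (+-comm h 1)
next≡ h       horizontal-θ _ = ℤ.+-identityʳ (+ h)
next≡ h       horizontal-ξ _ = ℤ.+-identityʳ (+ h)
next≡ (suc h) down         _ = refl

-- A down-step from height 0 leaves no value for `b`.
choice⇒nonneg : ∀ h s {b} → b < choices h s → 0ℤ ℤ.≤ + h ℤ.+ rise s
choice⇒nonneg h       up           _ = ℤ.+≤+ z≤n
choice⇒nonneg h       horizontal-θ _ = ℤ.+≤+ z≤n
choice⇒nonneg h       horizontal-ξ _ = ℤ.+≤+ z≤n
choice⇒nonneg (suc h) down         _ = ℤ.+≤+ z≤n

-- `Motzkinᴮ` with a free starting point, since removing the first step of a path moves its start.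
NonNegative : ∀ {n} → Point → Path n → Set
NonNegative p π = ∀ i → 0ℤ ℤ.≤ height p π i

Bounded : ∀ {n} → Point → Path n → Vec ℕ n → Set
Bounded p π β = ∀ i → + lookup β i ℤ.≤ height p π (inject₁ i) ℤ.+ height p π (suc i)

-- Induction along the path; `proj₂ p ≡ + h` ties its integer heights to the natural number indexing
-- `Admissible`.
admissible⁺ : ∀ {n h p} (π : Path n) β → proj₂ p ≡ + h → NonNegative p π → Bounded p π β →
              Admissible h (x^ β θ T⟨ π ⟩ ξ S⟨ π ⟩)
admissible⁺ []      []      _    _      _       = nil
admissible⁺ {h = h} {p} (s ∷ π) (b ∷ β) refl nonneg bounded = cons s
  (subst (b <_) (sym (choices≡ h s h+s≥0))
    (s≤s (ℤ.drop‿+≤+ (subst (λ y → + b ℤ.≤ + h ℤ.+ y) (next≡ h s h+s≥0) (bounded zero)))))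
  (admissible⁺ {p = translate p (displacement s)} π β (next≡ h s h+s≥0) (nonneg ∘ suc) (bounded ∘ suc))
  where
  h+s≥0 = nonneg (suc zero)

admissible⁻ : ∀ {n h} {m : Monomial n} p → proj₂ p ≡ + h → Admissible h m →
              ∃[ π ] NonNegative p π × Monomial.θ-set m ≡ T⟨ π ⟩ × Monomial.ξ-set m ≡ S⟨ π ⟩
                     × Bounded p π (Monomial.exponent m)
admissible⁻ p refl nil = [] , (λ { zero → ℤ.+≤+ z≤n }) , refl , refl , λ ()
admissible⁻ {h = h} p refl (cons s {b} b< m-adm)
  with π , nonneg , T≡ , S≡ , bounded ←
    admissible⁻ (translate p (displacement s)) (next≡ h s (choice⇒nonneg h s b<)) m-adm
  = s ∷ π
  , (λ { zero → ℤ.+≤+ z≤n ; (suc i) → nonneg i })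
  , cong (has-θ s ∷_) T≡
  , cong (has-ξ s ∷_) S≡
  , λ { zero    → subst (λ y → + b ℤ.≤ + h ℤ.+ y) (sym (next≡ h s h+s≥0))
                    (ℤ.+≤+ (s≤s⁻¹ (subst (b <_) (choices≡ h s h+s≥0) b<)))
      ; (suc i) → bounded i }
  where
  h+s≥0 = choice⇒nonneg h s b<

Admissible⇔B : ∀ {n} (m : Monomial n) → Admissible 0 m ⇔ B⁽¹'²⁾ n m
Admissible⇔B {n} (x^ β θ T ξ S) = mk⇔ to from
  where
  to : Admissible 0 (x^ β θ T ξ S) → B⁽¹'²⁾ n (x^ β θ T ξ S)
  to m-adm with π , nonneg , refl , refl , bounded ← admissible⁻ (0ℤ , 0ℤ) refl m-adm
    = (π , nonneg , refl , refl)
    , λ i → subst (+ lookup β i ℤ.≤_) (sym (β-height π i)) (bounded i)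
  from : B⁽¹'²⁾ n (x^ β θ T ξ S) → Admissible 0 (x^ β θ T ξ S)
  from ((π , nonneg , refl , refl) , bounded) =
    admissible⁺ π β refl nonneg λ i → subst (+ lookup β i ℤ.≤_) (β-height π i) (bounded i)

theorem9p10 : (n : ℕ) → .{{_ : NonZero n}} → HasCardinality (B⁽¹'²⁾ n) (4 ^ n * n !)
theorem9p10 n =
    admissible n 0
  , admissible-unique n 0
  , (λ m → mk⇔ (Equivalence.to (Admissible⇔B m) ∘ admissible-sound n 0)
               (admissible-complete ∘ Equivalence.from (Admissible⇔B m)))
  , trans (length-admissible n 0) (count-zero n)
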